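{- Let $t\ge1$ and let $\ell_1,\dots,\ell_t$ be distinct positive integers. For an integer $n>2t+1$ put $m=n-1$ and let $f_t:\{ -1,1\}^m\to\mathbb R$ be $$f_t(\boldsymbol z)=2^{ -t}\prod_{j=1}^{t}\bigl(n-4\ell_j-S(\boldsymbol z)-P(\boldsymbol z)\bigr),\qquad S(\boldsymbol z)=\sum_{i=1}^{m}z_i,\quad P(\boldsymbol z)=\prod_{i=1}^{m}z_i .$$ Then there are polynomials $R_{t,s}$ ($0\le s\le t$) and $R'_{t,s}$ ($0\le s\le t-1$) in the variable $n$, whose coefficients depend polynomially on $\ell_1,\dots,\ell_t$, such that for every $n>2t+1$ and every $T\subseteq[m]$ the following hold. (i) If $|T|=s$ with $0\le s\le t$, then $$\widehat f_t(T)=\frac{(-1)^s}{2^t}\,\frac{t!}{(t-s)!}\,n^{t-s}+R_{t,s}(n),$$ where $R_{t,s}$ has degree at most $t-s-1$ in $n$; in particular $R_{t,t}=0$. (ii) If $|T|=m-s$ with $0\le s\le t-1$, then $$\widehat f_t(T)=\frac{(-1)^{s+1}}{2^t}\,\frac{t!}{(t-s-1)!}\,n^{t-1-s}+R'_{t,s}(n),$$ where $R'_{t,s}$ has degree at most $t-s-2$ in $n$; in particular $R'_{t,t-1}=0$. (iii) If $t<|T|<m-t+1$, then $\widehat f_t(T)=0$.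
   Context: $[m]=\{1,\dots,m\}$. For $T\subseteq[m]$ the character $\chi_T:\{ -1,1\}^m\to\mathbb R$ is $\chi_T(\boldsymbol z)=\prod_{i\in T}z_i$, and the Fourier coefficient of $h:\{ -1,1\}^m\to\mathbb R$ at $T$ is $\widehat h(T)=2^{ -m}\sum_{\boldsymbol z\in\{ -1,1\}^m}h(\boldsymbol z)\chi_T(\boldsymbol z)$. By convention, any polynomial of negative degree is identically zero. -}

module Defs where

open import Algebra.Bundles using (CommutativeRing)
open import Data.Bool using (if_then_else_)
open import Data.Fin using (Fin; toℕ)
open import Data.Fin.Subset using (Subset)
open import Data.Integer as ℤ using (ℤ; +_)
open import Data.List as List using (List; []; _∷_; length)
open import Data.List.Relation.Unary.All using (All)
open import Data.Nat as ℕ using (ℕ; zero; suc; _!)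
open import Data.Nat.Properties using (_!≢0)
open import Data.Rational using (ℚ; 0ℚ; 1ℚ; ½; _+_; _*_; _-_; _/_)
open import Data.Rational.Properties using (+-*-commutativeRing; +-0-commutativeMonoid; *-1-commutativeMonoid)
open import Data.Sign using (Sign)
open import Data.Vec as Vec using (Vec; []; _∷_; lookup)
open import Data.Vec.Functional using (Vector; head; tail)
open import Relation.Binary.PropositionalEquality using (_≡_)

open import Algebra.Properties.Semiring.Exp (CommutativeRing.semiring +-*-commutativeRing) public
  using (_^_)
open import Algebra.Properties.CommutativeMonoid.Sum +-0-commutativeMonoid public
  using () renaming (sum to ∑)
open import Algebra.Properties.CommutativeMonoid.Sum *-1-commutativeMonoid public
  using () renaming (sum to ∏)

fromℕ : ℕ → ℚ
fromℕ n = + n / 1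

_!/_! : ℕ → ℕ → ℚ
a !/ b ! = (+ (a !) / (b !)) {{b !≢0}}

------------------------------------------------------------------------
-- Fourier analysis on {-1,1}^m.
-- All functions considered take rational values at every point of the cube,
-- so ℚ serves as the codomain in place of ℝ.

Cube : ℕ → Set
Cube m = Vec Sign m

value : Sign → ℚ
value ε = (ε ℤ.◃ 1) / 1

sumCube : ∀ m → (Cube m → ℚ) → ℚ
sumCube zero    h = h []
sumCube (suc m) h = sumCube m (λ z → h (Sign.+ ∷ z)) + sumCube m (λ z → h (Sign.- ∷ z))

χ : ∀ {m} → Subset m → Cube m → ℚ
χ T z = ∏ (λ i → if lookup T i then value (lookup z i) else 1ℚ)

fourier : ∀ {m} → (Cube m → ℚ) → Subset m → ℚ
fourier {m} h T = ½ ^ m * sumCube m (λ z → h z * χ T z)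

S : ∀ {m} → Cube m → ℚ
S z = ∑ (λ i → value (lookup z i))

P : ∀ {m} → Cube m → ℚ
P z = ∏ (λ i → value (lookup z i))

f : ∀ {t} → (Fin t → ℕ) → (n : ℕ) → Cube (n ℕ.∸ 1) → ℚ
f {t} ℓ n z = ½ ^ t * ∏ (λ j → fromℕ n - fromℕ 4 * fromℕ (ℓ j) - S z - P z)

------------------------------------------------------------------------
-- Polynomials over ℚ in k variables.
-- Poly (suc k) is (Poly k)[x₀], as the list of coefficients of x₀⁰, x₀¹, …;
-- trailing zero coefficients are allowed.

Poly : ℕ → Set
Poly zero    = ℚ
Poly (suc k) = List (Poly k)

eval : ∀ k → Poly k → Vector ℚ k → ℚ
eval zero    c        x = c
eval (suc k) []       x = 0ℚ
eval (suc k) (c ∷ cs) x = eval k c (tail x) + head x * eval (suc k) cs x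

IsZero : ∀ k → Poly k → Set
IsZero zero    c = c ≡ 0ℚ
IsZero (suc k) p = All (IsZero k) p

-- The degree in the variable x₀ is at most d.  The bound is an integer, and a
-- negative one makes every coefficient vanish.
DegreeAtMost : ∀ k → ℤ → Poly (suc k) → Set
DegreeAtMost k d p = ∀ (i : Fin (length p)) → d ℤ.< + toℕ i → IsZero k (List.lookup p i)

-- The value at n of a polynomial in n whose coefficients are polynomials in ℓ.
evalAt : ∀ {t} → Poly (suc t) → (Fin t → ℕ) → ℕ → ℚ
evalAt {t} p ℓ n = eval (suc t) p (fromℕ n Data.Vec.Functional.∷ λ j → fromℕ (ℓ j))

{-# OPTIONS --safe #-}
-- The Fourier coefficients of a function h on the cube determine those of
-- (a − S − P)·h: multiplication by S moves the coefficient at T to the sets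
-- obtained by adding or removing one element, and multiplication by P moves it
-- to the complement.  Hence the coefficient of ∏ⱼ (n − 4ℓⱼ − S − P) at T is
-- low t ∣T∣ + high t ∣∁T∣ for two families satisfying the recurrence
--   u′(s) = (n − 4ℓ) u(s) − s u(s−1) − (n−1−s) u(s+1) − v(s),
-- where (u , v) is (low , high) or (high , low).  By induction on t, low t s is
-- a polynomial in n of degree ≤ t − s and high t s one of degree ≤ t − s − 1,
-- with explicit leading coefficients.  As m > 2t, at every T at least one of
-- the two terms vanishes, and for t < ∣T∣ < m − t + 1 both do.
module Submission where

open import Defs
open import Algebra.Bundles using (CommutativeRing)
import Algebra.Lattice.Properties.BooleanAlgebra as BooleanAlgebra
open import Data.Bool using (true; false; not; if_then_else_)
open import Data.Fin using (Fin; zero; suc; toℕ)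
open import Data.Fin.Properties using (toℕ<n; toℕ≤pred[n])
open import Data.Fin.Subset using (Subset; ∣_∣; ∁)
open import Data.Fin.Subset.Properties using (∣p∣≤n; ∣∁p∣≡n∸∣p∣; ∪-∩-booleanAlgebra)
open import Data.Integer as ℤ using (+_)
import Data.Integer.Properties as ℤ
import Data.Integer.Solver as ℤSolver
open import Data.List as List using ([]; _∷_; length)
open import Data.List.Properties using (length-map)
open import Data.List.Relation.Unary.All using ([])
open import Data.Nat as ℕ using (ℕ; zero; suc; pred; _∸_; _≤_; _<_; z≤n; s≤s; _!)
import Data.Nat.Properties as ℕ
import Data.Nat.Solver as ℕSolver
open import Data.Product using (Σ-syntax; _×_; _,_; proj₁; proj₂)
open import Data.Rational using (ℚ; 0ℚ; 1ℚ; ½; _+_; _*_; _-_; -_; _/_)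
import Data.Rational.Properties as ℚ
open import Data.Rational.Solver using (module +-*-Solver)
open import Data.Rational.Unnormalised using (mkℚᵘ; *≡*)
import Data.Rational.Unnormalised.Properties as ℚᵘ
open import Data.Sign as Sign using (Sign)
open import Data.Vec using ([]; _∷_; updateAt)
open import Data.Vec.Functional using (head; tail)
open import Function using (_∘_)
open import Function.Definitions using (Injective)
open import Relation.Binary.PropositionalEquality
open import Relation.Nullary using (contradiction)
open import Algebra.Properties.Semiring.Sum (CommutativeRing.semiring ℚ.+-*-commutativeRing)
  using (*-distribˡ-sum; sum-cong-≗)
open +-*-Solver
open ≡-Reasoning

private
  module N = ℕSolver.+-*-Solver
  module Z = ℤSolver.+-*-Solver

-- Natural numbers as rationals, and falling factorials

-- `_/_` normalises by a gcd and does not compute on variables, so the two sides are compared as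
-- unnormalised fractions.
fromℕ-+ : ∀ a b → fromℕ (a ℕ.+ b) ≡ fromℕ a + fromℕ b
fromℕ-+ a b = ℚ.toℚᵘ-injective (ℚᵘ.≃-trans (ℚ.toℚᵘ-fromℚᵘ (mkℚᵘ (+ (a ℕ.+ b)) 0))
  (ℚᵘ.≃-trans (*≡* (cong (ℤ._* + 1) (sym (cong₂ ℤ._+_ (ℤ.*-identityʳ (+ a)) (ℤ.*-identityʳ (+ b))))))
  (ℚᵘ.≃-sym (ℚᵘ.≃-trans (ℚ.toℚᵘ-homo-+ (fromℕ a) (fromℕ b))
    (ℚᵘ.+-cong (ℚ.toℚᵘ-fromℚᵘ (mkℚᵘ (+ a) 0)) (ℚ.toℚᵘ-fromℚᵘ (mkℚᵘ (+ b) 0)))))))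

fromℕ-* : ∀ a b → fromℕ (a ℕ.* b) ≡ fromℕ a * fromℕ b
fromℕ-* zero    b = sym (ℚ.*-zeroˡ (fromℕ b))
fromℕ-* (suc a) b = begin
  fromℕ (b ℕ.+ a ℕ.* b)           ≡⟨ fromℕ-+ b (a ℕ.* b) ⟩
  fromℕ b + fromℕ (a ℕ.* b)       ≡⟨ cong (λ z → fromℕ b + z) (fromℕ-* a b) ⟩
  fromℕ b + fromℕ a * fromℕ b     ≡⟨ solve 2 (λ x y → y :+ x :* y := (con 1ℚ :+ x) :* y) refl (fromℕ a) (fromℕ b) ⟩
  (1ℚ + fromℕ a) * fromℕ b        ≡⟨ cong (_* fromℕ b) (fromℕ-+ 1 a) ⟨
  fromℕ (suc a) * fromℕ b         ∎

*-/-cancel : ∀ c d .{{_ : ℕ.NonZero d}} → + (c ℕ.* d) / d ≡ fromℕ c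
*-/-cancel c (suc d) = ℚ.fromℚᵘ-cong {mkℚᵘ (+ (c ℕ.* suc d)) d} {mkℚᵘ (+ c) 0}
  (*≡* (trans (ℤ.*-identityʳ (+ (c ℕ.* suc d))) (ℤ.pos-* c (suc d))))

infixl 7 _↓_

-- The falling factorial k(k-1)⋯(k-s+1). Unlike k!/(k-s)! it is also meaningful for s > k, where it
-- is 0, so the leading coefficients need no case distinction on the range of s.
_↓_ : ℕ → ℕ → ℕ
k     ↓ zero  = 1
zero  ↓ suc s = 0
suc k ↓ suc s = suc k ℕ.* (k ↓ s)

-- Combinatorially, an injective (s+1)-tuple from k+1 elements either avoids a marked element or has
-- it in one of s+1 places. Up to sign, the leading coefficients obey this rule.
↓-rec : ∀ k s → suc k ↓ suc s ≡ k ↓ suc s ℕ.+ suc s ℕ.* (k ↓ s)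
↓-rec zero    zero    = refl
↓-rec zero    (suc s) = sym (ℕ.*-zeroʳ s)
↓-rec (suc k) zero    = ℕ.+-comm 1 (suc k ℕ.* 1)
↓-rec (suc k) (suc s) = begin
  suc (suc k) ℕ.* a                              ≡⟨⟩
  a ℕ.+ suc k ℕ.* a                              ≡⟨ cong (λ x → a ℕ.+ suc k ℕ.* x) (↓-rec k s) ⟩
  a ℕ.+ suc k ℕ.* (c ℕ.+ suc s ℕ.* b)            ≡⟨ N.solve 4 (λ k s b c →
      (N.con 1 N.:+ k) N.:* b N.:+ (N.con 1 N.:+ k) N.:* (c N.:+ (N.con 1 N.:+ s) N.:* b)
        N.:= (N.con 1 N.:+ k) N.:* c N.:+ (N.con 2 N.:+ s) N.:* ((N.con 1 N.:+ k) N.:* b)) refl k s b c ⟩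
  suc k ℕ.* c ℕ.+ suc (suc s) ℕ.* a              ∎
  where
  a = suc k ↓ suc s
  b = k ↓ s
  c = k ↓ suc s

↓-! : ∀ {k s} → s ≤ k → k ! ≡ (k ↓ s) ℕ.* (k ∸ s) !
↓-! {k}     {zero}  z≤n       = sym (ℕ.+-identityʳ (k !))
↓-! {suc k} {suc s} (s≤s s≤k) = trans (cong (suc k ℕ.*_) (↓-! s≤k)) (sym (ℕ.*-assoc (suc k) (k ↓ s) ((k ∸ s) !)))

!/!≡↓ : ∀ {k s} → s ≤ k → k !/ (k ∸ s) ! ≡ fromℕ (k ↓ s)
!/!≡↓ {k} {s} s≤k rewrite ↓-! s≤k = *-/-cancel (k ↓ s) ((k ∸ s) !) {{(k ∸ s) ℕ.!≢0}}

-- Polynomials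

constP : ∀ k → ℚ → Poly k
constP zero    c = c
constP (suc k) c = constP k c ∷ []

addP : ∀ k → Poly k → Poly k → Poly k
addP zero    a        b        = a + b
addP (suc k) []       q        = q
addP (suc k) (a ∷ p)  []       = a ∷ p
addP (suc k) (a ∷ p)  (b ∷ q)  = addP k a b ∷ addP (suc k) p q

scaleP : ∀ k → ℚ → Poly k → Poly k
scaleP zero    r a = r * a
scaleP (suc k) r p = List.map (scaleP k r) p

monomial : ∀ k → ℚ → ℕ → Poly (suc k)
monomial k c zero    = constP k c ∷ []
monomial k c (suc e) = constP k 0ℚ ∷ monomial k c e

eval-const : ∀ k c x → eval k (constP k c) x ≡ c
eval-const zero    c x = refl
eval-const (suc k) c x = begin
  eval k (constP k c) (tail x) + head x * 0ℚ  ≡⟨ cong (_+ head x * 0ℚ) (eval-const k c (tail x)) ⟩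
  c + head x * 0ℚ                             ≡⟨ solve 2 (λ c x → c :+ x :* con 0ℚ := c) refl c (head x) ⟩
  c                                           ∎

eval-add : ∀ k p q x → eval k (addP k p q) x ≡ eval k p x + eval k q x
eval-add zero    a       b       x = refl
eval-add (suc k) []      q       x = sym (ℚ.+-identityˡ _)
eval-add (suc k) (a ∷ p) []      x = sym (ℚ.+-identityʳ _)
eval-add (suc k) (a ∷ p) (b ∷ q) x = trans
  (cong₂ (λ y z → y + head x * z) (eval-add k a b (tail x)) (eval-add (suc k) p q x))
  (solve 5 (λ a b p q x → (a :+ b) :+ x :* (p :+ q) := (a :+ x :* p) :+ (b :+ x :* q)) refl
    (eval k a (tail x)) (eval k b (tail x)) (eval (suc k) p x) (eval (suc k) q x) (head x))

eval-scale : ∀ k r p x → eval k (scaleP k r p) x ≡ r * eval k p x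
eval-scale zero    r a       x = refl
eval-scale (suc k) r []      x = sym (ℚ.*-zeroʳ r)
eval-scale (suc k) r (a ∷ p) x = trans
  (cong₂ (λ y z → y + head x * z) (eval-scale k r a (tail x)) (eval-scale (suc k) r p x))
  (solve 4 (λ r a p x → r :* a :+ x :* (r :* p) := r :* (a :+ x :* p)) refl
    r (eval k a (tail x)) (eval (suc k) p x) (head x))

eval-shift : ∀ k p x → eval (suc k) (constP k 0ℚ ∷ p) x ≡ head x * eval (suc k) p x
eval-shift k p x = trans (cong (_+ head x * eval (suc k) p x) (eval-const k 0ℚ (tail x))) (ℚ.+-identityˡ _)

eval-monomial : ∀ k c e x → eval (suc k) (monomial k c e) x ≡ c * head x ^ e
eval-monomial k c zero    x = trans (eval-const (suc k) c x) (sym (ℚ.*-identityʳ c))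
eval-monomial k c (suc e) x = begin
  eval (suc k) (monomial k c (suc e)) x  ≡⟨ eval-shift k (monomial k c e) x ⟩
  head x * eval (suc k) (monomial k c e) x ≡⟨ cong (head x *_) (eval-monomial k c e x) ⟩
  head x * (c * head x ^ e)              ≡⟨ solve 3 (λ x c y → x :* (c :* y) := c :* (x :* y)) refl (head x) c (head x ^ e) ⟩
  c * head x ^ suc e                     ∎

-- Lengths serve as degree bounds: a list of length at most e has degree below e in its outermost
-- variable, which `evalAt` sets to n.
length-add : ∀ k {e} (p q : Poly (suc k)) → length p ≤ e → length q ≤ e → length (addP (suc k) p q) ≤ e
length-add k []      q       hp       hq       = hq
length-add k (a ∷ p) []      hp       hq       = hp
length-add k (a ∷ p) (b ∷ q) (s≤s hp) (s≤s hq) = s≤s (length-add k p q hp hq)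

length-scale : ∀ k {e} r (p : Poly (suc k)) → length p ≤ e → length (scaleP (suc k) r p) ≤ e
length-scale k r p = subst (_≤ _) (sym (length-map (scaleP k r) p))

length-monomial : ∀ k c e → length (monomial k c e) ≡ suc e
length-monomial k c zero    = refl
length-monomial k c (suc e) = cong suc (length-monomial k c e)

-- The variables are ordered n, ℓ₀, ℓ₁, ..., so a new first ℓ goes just beneath n. Adjoining it, or
-- multiplying by it as in `mulNewP`, acts on each coefficient separately and leaves the degree in n
-- unchanged.
liftP : ∀ {t} → Poly (suc t) → Poly (suc (suc t))
liftP = List.map (_∷ [])

mulNewP : ∀ {t} → Poly (suc t) → Poly (suc (suc t))
mulNewP {t} = List.map (λ a → constP t 0ℚ ∷ a ∷ [])

Family : ℕ → Set
Family t = (Fin t → ℕ) → ℕ → ℚ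

evalAt-lift : ∀ {t} (p : Poly (suc t)) ℓ n → evalAt (liftP p) ℓ n ≡ evalAt p (ℓ ∘ suc) n
evalAt-lift         []      ℓ n = refl
evalAt-lift {t} (a ∷ p) ℓ n = cong₂ (λ y z → y + fromℕ n * z)
  (solve 2 (λ a x → a :+ x :* con 0ℚ := a) refl (eval t a _) (fromℕ (ℓ zero))) (evalAt-lift p ℓ n)

evalAt-mulNew : ∀ {t} (p : Poly (suc t)) ℓ n → evalAt (mulNewP p) ℓ n ≡ fromℕ (ℓ zero) * evalAt p (ℓ ∘ suc) n
evalAt-mulNew     []      ℓ n = sym (ℚ.*-zeroʳ (fromℕ (ℓ zero)))
evalAt-mulNew {t} (a ∷ p) ℓ n = trans
  (cong₂ (λ y z → y + fromℕ n * z) (eval-shift t (a ∷ []) (λ j → fromℕ (ℓ j))) (evalAt-mulNew p ℓ n))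
  (solve 4 (λ l a n p → l :* (a :+ l :* con 0ℚ) :+ n :* (l :* p) := l :* (a :+ n :* p)) refl
    (fromℕ (ℓ zero)) (eval t a (λ j → fromℕ (ℓ (suc j)))) (fromℕ n) (evalAt p (ℓ ∘ suc) n))

-- D bounds the degree in n from above by D − 1, and c is the coefficient of
-- n^(D−1); the shift by one makes D = 0 the zero polynomial.
Leading : ∀ {t} → ℕ → ℚ → Family t → Set
Leading     zero    c φ = c ≡ 0ℚ × (∀ ℓ n → φ ℓ n ≡ 0ℚ)
Leading {t} (suc e) c φ = Σ[ p ∈ Poly (suc t) ] length p ≤ e × (∀ ℓ n → φ ℓ n ≡ c * fromℕ n ^ e + evalAt p ℓ n)

-- Closure of `Leading` under the operations of the recurrence.

private variable
  m t D : ℕ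
  c d : ℚ
  φ ψ : Family t

leading-cong : c ≡ d → (∀ ℓ n → φ ℓ n ≡ ψ ℓ n) → Leading D c φ → Leading D d ψ
leading-cong {D = zero}  refl eq (c≡0 , h)     = c≡0 , λ ℓ n → trans (sym (eq ℓ n)) (h ℓ n)
leading-cong {D = suc D} refl eq (p , len , h) = p , len , λ ℓ n → trans (sym (eq ℓ n)) (h ℓ n)

leading-0 : ∀ D → (∀ ℓ n → φ ℓ n ≡ 0ℚ) → Leading D 0ℚ φ
leading-0 zero    φ≡0 = refl , φ≡0
leading-0 (suc D) φ≡0 = [] , z≤n , λ ℓ n →
  trans (φ≡0 ℓ n) (solve 1 (λ x → con 0ℚ := con 0ℚ :* x :+ con 0ℚ) refl (fromℕ n ^ D))

leading-+ : Leading D c φ → Leading D d ψ → Leading D (c + d) (λ ℓ n → φ ℓ n + ψ ℓ n)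
leading-+ {D = zero} (refl , h) (refl , h′) = refl , λ ℓ n → cong₂ _+_ (h ℓ n) (h′ ℓ n)
leading-+ {D = suc D} {c = c} {φ = φ} {d = d} {ψ = ψ} (p , len , h) (q , len′ , h′) =
  addP _ p q , length-add _ p q len len′ , λ ℓ n → begin
    φ ℓ n + ψ ℓ n ≡⟨ cong₂ _+_ (h ℓ n) (h′ ℓ n) ⟩
    (c * fromℕ n ^ D + evalAt p ℓ n) + (d * fromℕ n ^ D + evalAt q ℓ n)
      ≡⟨ solve 5 (λ c d x p q → (c :* x :+ p) :+ (d :* x :+ q) := (c :+ d) :* x :+ (p :+ q)) refl
           c d (fromℕ n ^ D) (evalAt p ℓ n) (evalAt q ℓ n) ⟩
    (c + d) * fromℕ n ^ D + (evalAt p ℓ n + evalAt q ℓ n)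
      ≡⟨ cong (λ z → (c + d) * fromℕ n ^ D + z) (eval-add _ p q _) ⟨
    (c + d) * fromℕ n ^ D + evalAt (addP _ p q) ℓ n ∎

leading-scale : ∀ r → Leading D c φ → Leading D (r * c) (λ ℓ n → r * φ ℓ n)
leading-scale {D = zero} r (refl , h) = ℚ.*-zeroʳ r , λ ℓ n → trans (cong (r *_) (h ℓ n)) (ℚ.*-zeroʳ r)
leading-scale {D = suc D} {c = c} {φ = φ} r (p , len , h) =
  scaleP _ r p , length-scale _ r p len , λ ℓ n → begin
    r * φ ℓ n ≡⟨ cong (r *_) (h ℓ n) ⟩
    r * (c * fromℕ n ^ D + evalAt p ℓ n)
      ≡⟨ solve 4 (λ r c x p → r :* (c :* x :+ p) := (r :* c) :* x :+ r :* p) refl r c (fromℕ n ^ D) (evalAt p ℓ n) ⟩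
    (r * c) * fromℕ n ^ D + r * evalAt p ℓ n
      ≡⟨ cong (λ z → (r * c) * fromℕ n ^ D + z) (eval-scale _ r p _) ⟨
    (r * c) * fromℕ n ^ D + evalAt (scaleP _ r p) ℓ n ∎

leading-n* : ∀ D → Leading D c φ → Leading (suc D) c (λ ℓ n → fromℕ n * φ ℓ n)
leading-n* zero (refl , h) = leading-0 1 λ ℓ n → trans (cong (fromℕ n *_) (h ℓ n)) (ℚ.*-zeroʳ (fromℕ n))
leading-n* {c = c} {φ = φ} (suc D) (p , len , h) = constP _ 0ℚ ∷ p , s≤s len , λ ℓ n → begin
    fromℕ n * φ ℓ n ≡⟨ cong (fromℕ n *_) (h ℓ n) ⟩
    fromℕ n * (c * fromℕ n ^ D + evalAt p ℓ n)
      ≡⟨ solve 4 (λ n c x p → n :* (c :* x :+ p) := c :* (n :* x) :+ n :* p) refl (fromℕ n) c (fromℕ n ^ D) (evalAt p ℓ n) ⟩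
    c * fromℕ n ^ suc D + fromℕ n * evalAt p ℓ n
      ≡⟨ cong (λ z → c * fromℕ n ^ suc D + z) (eval-shift _ p (fromℕ n Data.Vec.Functional.∷ λ j → fromℕ (ℓ j))) ⟨
    c * fromℕ n ^ suc D + evalAt (constP _ 0ℚ ∷ p) ℓ n ∎

-- With the larger bound the old leading term is no longer at the top: it moves into the remainder
-- as a monomial.
leading-weaken : ∀ D → Leading D c φ → Leading (suc D) 0ℚ φ
leading-weaken zero (refl , h) = leading-0 1 h
leading-weaken {c = c} {φ = φ} (suc D) (p , len , h) =
  addP _ (monomial _ c D) p ,
  length-add _ (monomial _ c D) p (ℕ.≤-reflexive (length-monomial _ c D)) (ℕ.m≤n⇒m≤1+n len) , λ ℓ n → begin
    φ ℓ n ≡⟨ h ℓ n ⟩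
    c * fromℕ n ^ D + evalAt p ℓ n
      ≡⟨ cong (_+ evalAt p ℓ n) (eval-monomial _ c D _) ⟨
    evalAt (monomial _ c D) ℓ n + evalAt p ℓ n
      ≡⟨ eval-add _ (monomial _ c D) p _ ⟨
    evalAt (addP _ (monomial _ c D) p) ℓ n
      ≡⟨ solve 2 (λ x y → y := con 0ℚ :* x :+ y) refl (fromℕ n ^ suc D) _ ⟩
    0ℚ * fromℕ n ^ suc D + evalAt (addP _ (monomial _ c D) p) ℓ n ∎

leading-lift : ∀ D → Leading D c φ → Leading D c (λ ℓ → φ (ℓ ∘ suc))
leading-lift zero (c≡0 , h) = c≡0 , λ ℓ → h (ℓ ∘ suc)
leading-lift {c = c} (suc D) (p , len , h) =
  liftP p , subst (_≤ D) (sym (length-map _ p)) len , λ ℓ n →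
    trans (h (ℓ ∘ suc) n) (cong (λ z → c * fromℕ n ^ D + z) (sym (evalAt-lift p ℓ n)))

-- The product with ℓ₀ would have a leading coefficient depending on ℓ, while `Leading` admits only
-- a rational constant. Hence the leading term is first moved into the remainder.
leading-ℓ* : ∀ D → Leading D c φ → Leading (suc D) 0ℚ (λ ℓ n → fromℕ (ℓ zero) * φ (ℓ ∘ suc) n)
leading-ℓ* {φ = φ} D L with leading-weaken D L
... | p , len , h = mulNewP p , subst (_≤ D) (sym (length-map _ p)) len , λ ℓ n → begin
    fromℕ (ℓ zero) * φ (ℓ ∘ suc) n ≡⟨ cong (fromℕ (ℓ zero) *_) (h (ℓ ∘ suc) n) ⟩
    fromℕ (ℓ zero) * (0ℚ * fromℕ n ^ D + evalAt p (ℓ ∘ suc) n)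
      ≡⟨ solve 3 (λ l x p → l :* (con 0ℚ :* x :+ p) := con 0ℚ :* x :+ l :* p) refl
           (fromℕ (ℓ zero)) (fromℕ n ^ D) (evalAt p (ℓ ∘ suc) n) ⟩
    0ℚ * fromℕ n ^ D + fromℕ (ℓ zero) * evalAt p (ℓ ∘ suc) n
      ≡⟨ cong (λ z → 0ℚ * fromℕ n ^ D + z) (evalAt-mulNew p ℓ n) ⟨
    0ℚ * fromℕ n ^ D + evalAt (mulNewP p) ℓ n ∎

-- The recurrence for the Fourier coefficients

-- `low 0` is the transform of the constant 1, supported at the empty set. The factor n - 1 - s is
-- ∣∁T∣ for ∣T∣ = s, taken in ℚ rather than truncated so that it is polynomial in n. `pred 0` occurs
-- only with coefficient 0.
low high : ∀ t → ℕ → Family t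
low zero zero    ℓ n = 1ℚ
low zero (suc s) ℓ n = 0ℚ
low (suc t) s ℓ n =
  (fromℕ n - fromℕ 4 * fromℕ (ℓ zero)) * low t s (ℓ ∘ suc) n
  - fromℕ s * low t (pred s) (ℓ ∘ suc) n
  - (fromℕ n - 1ℚ - fromℕ s) * low t (suc s) (ℓ ∘ suc) n
  - high t s (ℓ ∘ suc) n
high zero s ℓ n = 0ℚ
high (suc t) s ℓ n =
  (fromℕ n - fromℕ 4 * fromℕ (ℓ zero)) * high t s (ℓ ∘ suc) n
  - fromℕ s * high t (pred s) (ℓ ∘ suc) n
  - (fromℕ n - 1ℚ - fromℕ s) * high t (suc s) (ℓ ∘ suc) n
  - low t s (ℓ ∘ suc) n

-- For s ≤ D the new bound is `suc (D ∸ s)` and the untruncated lemma applies. For s > D both bounds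
-- are 0 and the family is zero. The next two lemmas split in the same way.
leading-n*-∸ : ∀ D s → Leading (D ∸ s) c φ → Leading (suc D ∸ s) c (λ ℓ n → fromℕ n * φ ℓ n)
leading-n*-∸ D       zero    L       = leading-n* D L
leading-n*-∸ (suc D) (suc s) L       = leading-n*-∸ D s L
leading-n*-∸ zero    (suc s) (refl , h) =
  leading-0 (zero ∸ s) λ ℓ n → trans (cong (fromℕ n *_) (h ℓ n)) (ℚ.*-zeroʳ (fromℕ n))

leading-weaken-∸ : ∀ D s → Leading (D ∸ s) c φ → Leading (suc D ∸ s) 0ℚ φ
leading-weaken-∸ D       zero    L       = leading-weaken D L
leading-weaken-∸ (suc D) (suc s) L       = leading-weaken-∸ D s L
leading-weaken-∸ zero    (suc s) (_ , h) = leading-0 (zero ∸ s) h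

leading-ℓ*-∸ : ∀ D s → Leading (D ∸ s) c φ → Leading (suc D ∸ s) 0ℚ (λ ℓ n → fromℕ (ℓ zero) * φ (ℓ ∘ suc) n)
leading-ℓ*-∸ D       zero    L       = leading-ℓ* D L
leading-ℓ*-∸ (suc D) (suc s) L       = leading-ℓ*-∸ D s L
leading-ℓ*-∸ zero    (suc s) (_ , h) = leading-0 (zero ∸ s) λ ℓ n →
  trans (cong (fromℕ (ℓ zero) *_) (h (ℓ ∘ suc) n)) (ℚ.*-zeroʳ (fromℕ (ℓ zero)))

-- Lowering the index by one raises the degree bound by one, so this term reaches the top degree
-- without a factor n.
leading-s* : ∀ D (a : ℕ → ℚ) (u : ℕ → Family t) → (∀ s → Leading (D ∸ s) (a s) (u s)) →
             ∀ s → Leading (suc D ∸ s) (fromℕ s * a (pred s)) (λ ℓ n → fromℕ s * u (pred s) ℓ n)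
leading-s* D a u L zero    = leading-cong {D = suc D} (sym (ℚ.*-zeroˡ (a 0))) (λ _ _ → refl) (leading-0 (suc D) λ ℓ n → ℚ.*-zeroˡ (u 0 ℓ n))
leading-s* D a u L (suc s) = leading-scale (fromℕ (suc s)) (L s)

-- Only n·u(s), s·u(s-1) and v(s) can reach the new top degree. The factor 4ℓ does not raise the
-- degree in n, and u(s+1) starts two below the new bound, so even n·u(s+1) stays under it.
leading-step : ∀ D (a : ℕ → ℚ) (u v : ℕ → Family t) → (∀ s → Leading (D ∸ s) (a s) (u s)) →
  ∀ s → Leading (suc D ∸ s) c (v s) →
  Leading (suc D ∸ s) (a s - fromℕ s * a (pred s) - c) (λ ℓ n →
    (fromℕ n - fromℕ 4 * fromℕ (ℓ zero)) * u s (ℓ ∘ suc) n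
    - fromℕ s * u (pred s) (ℓ ∘ suc) n
    - (fromℕ n - 1ℚ - fromℕ s) * u (suc s) (ℓ ∘ suc) n
    - v s (ℓ ∘ suc) n)
leading-step {c = c} D a u v L s Lv = leading-cong
  (solve 5 (λ x y z f q → x :+ (:- con 1ℚ :* (f :* con 0ℚ) :+ (:- con 1ℚ :* y :+ (:- con 1ℚ :* con 0ℚ :+ ((con 1ℚ :+ q) :* con 0ℚ :+ :- con 1ℚ :* z))))
      := x :- y :- z) refl (a s) (fromℕ s * a (pred s)) c (fromℕ 4) (fromℕ s))
  -- The right-hand side is split into six summands, n - 1 - s into n and -(1 + s), in the order of
  -- the closure lemmas applied below.
  (λ ℓ n → solve 8 (λ n f l q x y z w →
      n :* x :+ (:- con 1ℚ :* (f :* (l :* x)) :+ (:- con 1ℚ :* (q :* y)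
        :+ (:- con 1ℚ :* (n :* z) :+ ((con 1ℚ :+ q) :* z :+ :- con 1ℚ :* w))))
      := (n :- f :* l) :* x :- q :* y :- (n :- con 1ℚ :- q) :* z :- w) refl
      (fromℕ n) (fromℕ 4) (fromℕ (ℓ zero)) (fromℕ s)
      (u s (ℓ ∘ suc) n) (u (pred s) (ℓ ∘ suc) n) (u (suc s) (ℓ ∘ suc) n) (v s (ℓ ∘ suc) n))
  (leading-+ (leading-lift _ (leading-n*-∸ D s (L s)))
  (leading-+ (leading-scale (- 1ℚ) (leading-scale (fromℕ 4) (leading-ℓ*-∸ D s (L s))))
  (leading-+ (leading-scale (- 1ℚ) (leading-lift _ (leading-s* D a u L s)))
  -- `suc D ∸ suc s` computes to `D ∸ s`, so a bound obtained at index `suc s` is again usable at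
  -- index `s`.
  (leading-+ (leading-scale (- 1ℚ) (leading-lift _ (leading-weaken-∸ D s (leading-n*-∸ D (suc s) (L (suc s))))))
  (leading-+ (leading-scale (1ℚ + fromℕ s) (leading-lift _ (leading-weaken-∸ D s (leading-weaken-∸ D (suc s) (L (suc s))))))
             (leading-scale (- 1ℚ) (leading-lift _ Lv)))))))

-- `highLead t s` and `lowLead t (suc s)` are the same by definition; `highLead-rec` relies on this.
lowLead highLead : ℕ → ℕ → ℚ
lowLead  t s = (- 1ℚ) ^ s * fromℕ (t ↓ s)
highLead t s = (- 1ℚ) ^ suc s * fromℕ (t ↓ suc s)

fromℕ-↓-rec : ∀ t s → fromℕ (suc t ↓ suc s) ≡ fromℕ (t ↓ suc s) + (1ℚ + fromℕ s) * fromℕ (t ↓ s)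
fromℕ-↓-rec t s = begin
  fromℕ (suc t ↓ suc s) ≡⟨ cong fromℕ (↓-rec t s) ⟩
  fromℕ (t ↓ suc s ℕ.+ suc s ℕ.* (t ↓ s)) ≡⟨ fromℕ-+ (t ↓ suc s) _ ⟩
  fromℕ (t ↓ suc s) + fromℕ (suc s ℕ.* (t ↓ s)) ≡⟨ cong (λ z → fromℕ (t ↓ suc s) + z) (fromℕ-* (suc s) (t ↓ s)) ⟩
  fromℕ (t ↓ suc s) + fromℕ (suc s) * fromℕ (t ↓ s) ≡⟨ cong (λ z → fromℕ (t ↓ suc s) + z * fromℕ (t ↓ s)) (fromℕ-+ 1 s) ⟩
  fromℕ (t ↓ suc s) + (1ℚ + fromℕ s) * fromℕ (t ↓ s) ∎

lowLead-rec : ∀ t s → lowLead t s - fromℕ s * lowLead t (pred s) - 0ℚ ≡ lowLead (suc t) s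
lowLead-rec t zero    = refl
lowLead-rec t (suc s) = begin
  - 1ℚ * σ * x - fromℕ (suc s) * (σ * y) - 0ℚ
    ≡⟨ cong (λ q → - 1ℚ * σ * x - q * (σ * y) - 0ℚ) (fromℕ-+ 1 s) ⟩
  - 1ℚ * σ * x - (1ℚ + fromℕ s) * (σ * y) - 0ℚ
    ≡⟨ solve 4 (λ σ x y q → :- con 1ℚ :* σ :* x :- (con 1ℚ :+ q) :* (σ :* y) :- con 0ℚ
         := :- con 1ℚ :* σ :* (x :+ (con 1ℚ :+ q) :* y)) refl σ x y (fromℕ s) ⟩
  - 1ℚ * σ * (x + (1ℚ + fromℕ s) * y) ≡⟨ cong (- 1ℚ * σ *_) (fromℕ-↓-rec t s) ⟨
  - 1ℚ * σ * fromℕ (suc t ↓ suc s) ∎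
  where
  σ = (- 1ℚ) ^ s
  x = fromℕ (t ↓ suc s)
  y = fromℕ (t ↓ s)

-- The index of the falling factorial is s + 1 while the recurrence supplies only the factor s; the
-- coupled term `lowLead t s` provides the missing copy.
highLead-rec : ∀ t s → highLead t s - fromℕ s * highLead t (pred s) - lowLead t s ≡ highLead (suc t) s
highLead-rec t s = begin
  - 1ℚ * σ * x - fromℕ s * highLead t (pred s) - σ * y
    ≡⟨ cong (λ z → - 1ℚ * σ * x - z - σ * y) (s*highLead s) ⟩
  - 1ℚ * σ * x - fromℕ s * (σ * y) - σ * y
    ≡⟨ solve 4 (λ σ x y q → :- con 1ℚ :* σ :* x :- q :* (σ :* y) :- σ :* y
         := :- con 1ℚ :* σ :* (x :+ (con 1ℚ :+ q) :* y)) refl σ x y (fromℕ s) ⟩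
  - 1ℚ * σ * (x + (1ℚ + fromℕ s) * y) ≡⟨ cong (- 1ℚ * σ *_) (fromℕ-↓-rec t s) ⟨
  - 1ℚ * σ * fromℕ (suc t ↓ suc s) ∎
  where
  σ = (- 1ℚ) ^ s
  x = fromℕ (t ↓ suc s)
  y = fromℕ (t ↓ s)
  -- The shift by `pred` is wrong only at s = 0, where the factor s vanishes.
  s*highLead : ∀ s → fromℕ s * highLead t (pred s) ≡ fromℕ s * lowLead t s
  s*highLead zero    = trans (ℚ.*-zeroˡ (highLead t 0)) (sym (ℚ.*-zeroˡ (lowLead t 0)))
  s*highLead (suc s) = refl

-- Mutual induction on t. In the recurrence for `low` the coupled term `high t s` lies two below the
-- new bound, so it is weakened twice and contributes 0. In that for `high` the coupled term
-- `low t s` attains the bound and contributes `lowLead t s`.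
leading-low  : ∀ t s → Leading (suc t ∸ s) (lowLead t s) (low t s)
leading-high : ∀ t s → Leading (t ∸ s) (highLead t s) (high t s)
leading-low zero    zero    = [] , z≤n , λ ℓ n → refl
leading-low zero    (suc s) = leading-cong (sym (ℚ.*-zeroʳ ((- 1ℚ) ^ suc s))) (λ _ _ → refl) (leading-0 (0 ∸ s) λ _ _ → refl)
leading-low (suc t) s       = leading-cong (lowLead-rec t s) (λ _ _ → refl)
  (leading-step (suc t) (lowLead t) (low t) (high t) (leading-low t) s (leading-weaken-∸ (suc t) s (leading-weaken-∸ t s (leading-high t s))))
leading-high zero    s = leading-cong (sym (ℚ.*-zeroʳ ((- 1ℚ) ^ suc s))) (λ _ _ → refl) (leading-0 (0 ∸ s) λ _ _ → refl)
leading-high (suc t) s = leading-cong (highLead-rec t s) (λ _ _ → refl)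
  (leading-step t (highLead t) (high t) (low t) (leading-high t) s (leading-low t s))

-- Fourier analysis on the cube

sumCube-cong : ∀ {m} {g h : Cube m → ℚ} → (∀ z → g z ≡ h z) → sumCube m g ≡ sumCube m h
sumCube-cong {zero}  g≗h = g≗h []
sumCube-cong {suc m} g≗h = cong₂ _+_ (sumCube-cong {m} λ z → g≗h (Sign.+ ∷ z)) (sumCube-cong {m} λ z → g≗h (Sign.- ∷ z))

sumCube-+ : ∀ {m} (g h : Cube m → ℚ) → sumCube m (λ z → g z + h z) ≡ sumCube m g + sumCube m h
sumCube-+ {zero}  g h = refl
sumCube-+ {suc m} g h = trans (cong₂ _+_ (sumCube-+ {m} _ _) (sumCube-+ {m} _ _))
  (solve 4 (λ a b c d → (a :+ b) :+ (c :+ d) := (a :+ c) :+ (b :+ d)) refl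
    (sumCube m (g ∘ (Sign.+ ∷_))) (sumCube m (h ∘ (Sign.+ ∷_)))
    (sumCube m (g ∘ (Sign.- ∷_))) (sumCube m (h ∘ (Sign.- ∷_))))

sumCube-* : ∀ {m} r (h : Cube m → ℚ) → sumCube m (λ z → r * h z) ≡ r * sumCube m h
sumCube-* {zero}  r h = refl
sumCube-* {suc m} r h = trans (cong₂ _+_ (sumCube-* {m} r _) (sumCube-* {m} r _))
  (sym (ℚ.*-distribˡ-+ r (sumCube m (h ∘ (Sign.+ ∷_))) (sumCube m (h ∘ (Sign.- ∷_)))))

sumCube-∑ : ∀ {m k} (h : Fin k → Cube m → ℚ) → sumCube m (λ z → ∑ (λ i → h i z)) ≡ ∑ (λ i → sumCube m (h i))
sumCube-∑ {m} {zero}  h = trans (sumCube-* {m} 0ℚ (λ _ → 0ℚ)) (ℚ.*-zeroˡ (sumCube m (λ _ → 0ℚ)))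
sumCube-∑ {m} {suc k} h = trans (sumCube-+ {m} (h zero) _) (cong (λ w → sumCube m (h zero) + w) (sumCube-∑ (h ∘ suc)))

-- Multiplication of characters by S and P.

flip : Fin m → Subset m → Subset m
flip i T = updateAt T i not

value² : ∀ ε → value ε * value ε ≡ 1ℚ
value² Sign.+ = refl
value² Sign.- = refl

-- Since ε² = 1, multiplying by a coordinate toggles its membership in T. Toggling one coordinate at
-- a time gives `χ-flip`, toggling all at once gives `χ-∁`.
value-* : ∀ ε b → value ε * (if b then value ε else 1ℚ) ≡ (if not b then value ε else 1ℚ)
value-* ε true  = value² ε
value-* ε false = ℚ.*-identityʳ (value ε)

χ-flip : ∀ (T : Subset m) z → S z * χ T z ≡ ∑ (λ i → χ (flip i T) z)
χ-flip []      []      = refl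
χ-flip (t ∷ T) (ε ∷ z) = begin
  (v + S z) * (x t * χ T z)
    ≡⟨ solve 4 (λ v s x c → (v :+ s) :* (x :* c) := (v :* x) :* c :+ x :* (s :* c)) refl v (S z) (x t) (χ T z) ⟩
  v * x t * χ T z + x t * (S z * χ T z)
    ≡⟨ cong₂ (λ a b → a * χ T z + x t * b) (value-* ε t) (χ-flip T z) ⟩
  x (not t) * χ T z + x t * ∑ (λ i → χ (flip i T) z)
    ≡⟨ cong (λ a → x (not t) * χ T z + a) (*-distribˡ-sum (x t) (λ i → χ (flip i T) z)) ⟩
  x (not t) * χ T z + ∑ (λ i → x t * χ (flip i T) z) ∎
  where
  v = value ε
  x = λ b → if b then v else 1ℚ

χ-∁ : ∀ (T : Subset m) z → P z * χ T z ≡ χ (∁ T) z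
χ-∁ []      []      = refl
χ-∁ (t ∷ T) (ε ∷ z) = begin
  (v * P z) * (x t * χ T z)
    ≡⟨ solve 4 (λ v s x c → (v :* s) :* (x :* c) := (v :* x) :* (s :* c)) refl v (P z) (x t) (χ T z) ⟩
  (v * x t) * (P z * χ T z) ≡⟨ cong₂ _*_ (value-* ε t) (χ-∁ T z) ⟩
  x (not t) * χ (∁ T) z ∎
  where
  v = value ε
  x = λ b → if b then v else 1ℚ

-- Flipping one of the ∣T∣ members removes it, flipping one of the ∣∁T∣ others adds it. Both
-- cardinalities are arguments of `g`, since `low` will depend on the first and `high` on the
-- second; the induction shifts one argument according to the head of the subset.
∑-flip : ∀ (g : ℕ → ℕ → ℚ) (T : Subset m) →
  ∑ (λ i → g ∣ flip i T ∣ ∣ ∁ (flip i T) ∣)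
    ≡ fromℕ ∣ T ∣ * g (pred ∣ T ∣) (suc ∣ ∁ T ∣) + fromℕ ∣ ∁ T ∣ * g (suc ∣ T ∣) (pred ∣ ∁ T ∣)
∑-flip g [] = sym (trans (cong₂ _+_ (ℚ.*-zeroˡ (g 0 1)) (ℚ.*-zeroˡ (g 1 0))) refl)
∑-flip g (true ∷ T) = begin
  g a (suc b) + ∑ (λ i → g (suc ∣ flip i T ∣) ∣ ∁ (flip i T) ∣)
    ≡⟨ cong (λ w → g a (suc b) + w) (∑-flip (g ∘ suc) T) ⟩
  g a (suc b) + (fromℕ a * g (suc (pred a)) (suc b) + fromℕ b * y)
    ≡⟨ cong (λ w → g a (suc b) + (w + fromℕ b * y)) (suc-pred* a) ⟩
  g a (suc b) + (fromℕ a * g a (suc b) + fromℕ b * y)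
    ≡⟨ solve 4 (λ x a b y → x :+ (a :* x :+ b :* y) := (con 1ℚ :+ a) :* x :+ b :* y) refl (g a (suc b)) (fromℕ a) (fromℕ b) y ⟩
  (1ℚ + fromℕ a) * g a (suc b) + fromℕ b * y
    ≡⟨ cong (λ w → w * g a (suc b) + fromℕ b * y) (fromℕ-+ 1 a) ⟨
  fromℕ (suc a) * g a (suc b) + fromℕ b * y ∎
  where
  a = ∣ T ∣
  b = ∣ ∁ T ∣
  y = g (suc (suc a)) (pred b)
  -- `suc (pred k)` differs from k only at k = 0, where the coefficient vanishes.
  suc-pred* : ∀ k → fromℕ k * g (suc (pred k)) (suc b) ≡ fromℕ k * g k (suc b)
  suc-pred* zero    = trans (ℚ.*-zeroˡ (g 1 (suc b))) (sym (ℚ.*-zeroˡ (g 0 (suc b))))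
  suc-pred* (suc k) = refl
∑-flip g (false ∷ T) = begin
  g (suc a) b + ∑ (λ i → g ∣ flip i T ∣ (suc ∣ ∁ (flip i T) ∣))
    ≡⟨ cong (λ w → g (suc a) b + w) (∑-flip (λ k → g k ∘ suc) T) ⟩
  g (suc a) b + (fromℕ a * y + fromℕ b * g (suc a) (suc (pred b)))
    ≡⟨ cong (λ w → g (suc a) b + (fromℕ a * y + w)) (suc-pred* b) ⟩
  g (suc a) b + (fromℕ a * y + fromℕ b * g (suc a) b)
    ≡⟨ solve 4 (λ x a b y → x :+ (a :* y :+ b :* x) := a :* y :+ (con 1ℚ :+ b) :* x) refl (g (suc a) b) (fromℕ a) (fromℕ b) y ⟩
  fromℕ a * y + (1ℚ + fromℕ b) * g (suc a) b
    ≡⟨ cong (λ w → fromℕ a * y + w * g (suc a) b) (fromℕ-+ 1 b) ⟨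
  fromℕ a * y + fromℕ (suc b) * g (suc a) b ∎
  where
  a = ∣ T ∣
  b = ∣ ∁ T ∣
  y = g (pred a) (suc (suc b))
  suc-pred* : ∀ k → fromℕ k * g (suc a) (suc (pred k)) ≡ fromℕ k * g (suc a) k
  suc-pred* zero    = trans (ℚ.*-zeroˡ (g (suc a) 1)) (sym (ℚ.*-zeroˡ (g (suc a) 0)))
  suc-pred* (suc k) = refl

∣T∣+∣∁T∣ : ∀ (T : Subset m) → ∣ T ∣ ℕ.+ ∣ ∁ T ∣ ≡ m
∣T∣+∣∁T∣ T = trans (cong (∣ T ∣ ℕ.+_) (∣∁p∣≡n∸∣p∣ T)) (ℕ.m+[n∸m]≡n (∣p∣≤n T))

fourier-* : ∀ r (h : Cube m → ℚ) T → fourier (λ z → r * h z) T ≡ r * fourier h T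
fourier-* {m} r h T = begin
  ½ ^ m * sumCube m (λ z → r * h z * χ T z)
    ≡⟨ cong (½ ^ m *_) (trans (sumCube-cong λ z → ℚ.*-assoc r (h z) (χ T z)) (sumCube-* {m} r _)) ⟩
  ½ ^ m * (r * sumCube m (λ z → h z * χ T z))
    ≡⟨ solve 3 (λ a r b → a :* (r :* b) := r :* (a :* b)) refl (½ ^ m) r (sumCube m (λ z → h z * χ T z)) ⟩
  r * fourier h T ∎

-- Under the sum, S and P are moved from h onto the character, where `χ-flip` and `χ-∁` turn them
-- into changes of T.
fourier-step : ∀ a (h : Cube m → ℚ) T → fourier (λ z → (a - S z - P z) * h z) T
  ≡ a * fourier h T - ∑ (λ i → fourier h (flip i T)) - fourier h (∁ T)
fourier-step {m} a h T = begin
  ½ ^ m * sumCube m (λ z → (a - S z - P z) * h z * χ T z)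
    ≡⟨ cong (½ ^ m *_) (sumCube-cong pointwise) ⟩
  ½ ^ m * sumCube m (λ z → a * H T z + (- 1ℚ * ∑ (λ i → H (flip i T) z) + - 1ℚ * H (∁ T) z))
    ≡⟨ cong (½ ^ m *_) (trans (sumCube-+ {m} _ _) (cong₂ _+_ (sumCube-* {m} a _)
         (trans (sumCube-+ {m} _ _) (cong₂ _+_ (trans (sumCube-* {m} (- 1ℚ) _) (cong (- 1ℚ *_) (sumCube-∑ {m} (λ i → H (flip i T))))) (sumCube-* {m} (- 1ℚ) _))))) ⟩
  ½ ^ m * (a * sumCube m (H T) + (- 1ℚ * ∑ (λ i → sumCube m (H (flip i T))) + - 1ℚ * sumCube m (H (∁ T))))
    ≡⟨ solve 5 (λ w a x y z → w :* (a :* x :+ (:- con 1ℚ :* y :+ :- con 1ℚ :* z)) := a :* (w :* x) :- w :* y :- w :* z)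
         refl (½ ^ m) a (sumCube m (H T)) (∑ (λ i → sumCube m (H (flip i T)))) (sumCube m (H (∁ T))) ⟩
  a * fourier h T - ½ ^ m * ∑ (λ i → sumCube m (H (flip i T))) - fourier h (∁ T)
    ≡⟨ cong (λ w → a * fourier h T - w - fourier h (∁ T)) (*-distribˡ-sum (½ ^ m) (λ i → sumCube m (H (flip i T)))) ⟩
  a * fourier h T - ∑ (λ i → fourier h (flip i T)) - fourier h (∁ T) ∎
  where
  H : Subset m → Cube m → ℚ
  H U z = h z * χ U z
  pointwise : ∀ z → (a - S z - P z) * h z * χ T z ≡ a * H T z + (- 1ℚ * ∑ (λ i → H (flip i T) z) + - 1ℚ * H (∁ T) z)
  pointwise z = begin
    (a - S z - P z) * h z * χ T z
      ≡⟨ solve 5 (λ a s p h x → (a :- s :- p) :* h :* x := a :* (h :* x) :+ (:- con 1ℚ :* (h :* (s :* x)) :+ :- con 1ℚ :* (h :* (p :* x))))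
           refl a (S z) (P z) (h z) (χ T z) ⟩
    a * H T z + (- 1ℚ * (h z * (S z * χ T z)) + - 1ℚ * (h z * (P z * χ T z)))
      ≡⟨ cong₂ (λ x y → a * H T z + (- 1ℚ * x + - 1ℚ * (h z * y)))
           (trans (cong (h z *_) (χ-flip T z)) (*-distribˡ-sum (h z) (λ i → χ (flip i T) z))) (χ-∁ T z) ⟩
    a * H T z + (- 1ℚ * ∑ (λ i → H (flip i T) z) + - 1ℚ * H (∁ T) z) ∎

-- A coordinate in T makes the two halves of the cube cancel; a coordinate outside T doubles the
-- sum, which one factor ½ compensates.
fourier-1 : ∀ (T : Subset m) ℓ n → fourier (λ _ → 1ℚ) T ≡ low 0 ∣ T ∣ ℓ n
fourier-1 [] ℓ n = refl
fourier-1 {suc m} (b ∷ T) ℓ n = trans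
  (cong (½ ^ suc m *_) (cong₂ _+_ (pull Sign.+) (pull Sign.-))) (cases b)
  where
  s = sumCube m (λ z → 1ℚ * χ T z)
  x : Sign → ℚ
  x ε = if b then value ε else 1ℚ
  pull : ∀ ε → sumCube m (λ z → 1ℚ * χ (b ∷ T) (ε ∷ z)) ≡ x ε * s
  pull ε = trans (sumCube-cong λ z → solve 2 (λ x y → con 1ℚ :* (x :* y) := x :* (con 1ℚ :* y)) refl (x ε) (χ T z))
                 (sumCube-* {m} (x ε) _)
  cases : ∀ b → ½ ^ suc m * ((if b then value Sign.+ else 1ℚ) * s + (if b then value Sign.- else 1ℚ) * s) ≡ low 0 ∣ b ∷ T ∣ ℓ n
  cases true  = solve 2 (λ w s → w :* (con 1ℚ :* s :+ :- con 1ℚ :* s) := con 0ℚ) refl (½ ^ suc m) s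
  cases false = trans (solve 2 (λ w s → con ½ :* w :* (con 1ℚ :* s :+ con 1ℚ :* s) := w :* s) refl (½ ^ m) s) (fourier-1 T ℓ n)

-- Transform of the product of the t factors.

factors : ∀ {t} → (Fin t → ℕ) → ℕ → Cube m → ℚ
factors ℓ n z = ∏ (λ j → fromℕ n - fromℕ 4 * fromℕ (ℓ j) - S z - P z)

-- Passing to ∁T exchanges the two cardinalities, so P contributes -L b - H a. Grouping H a with the
-- terms at a = ∣T∣, and L b with those at b = ∣∁T∣, gives the two coupled recurrences.
fourier-factors : ∀ t (ℓ : Fin t → ℕ) (T : Subset m) →
  fourier (factors ℓ (suc m)) T ≡ low t (∣ T ∣) ℓ (suc m) + high t (∣ ∁ T ∣) ℓ (suc m)
fourier-factors {m} zero    ℓ T = trans (fourier-1 T ℓ (suc m)) (sym (ℚ.+-identityʳ _))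
fourier-factors {m} (suc t) ℓ T = begin
  fourier (factors ℓ n) T
    ≡⟨ fourier-step q (factors ℓ′ n) T ⟩
  q * F T - ∑ (λ i → F (flip i T)) - F (∁ T)
    ≡⟨ cong₂ (λ x y → q * x - y - F (∁ T)) (fourier-factors t ℓ′ T)
        (trans (sum-cong-≗ λ i → fourier-factors t ℓ′ (flip i T)) (∑-flip (λ a b → L a + H b) T)) ⟩
  q * (L a + H b) - (fromℕ a * (L (pred a) + H (suc b)) + fromℕ b * (L (suc a) + H (pred b))) - F (∁ T)
    ≡⟨ cong (λ x → q * (L a + H b) - (fromℕ a * (L (pred a) + H (suc b)) + fromℕ b * (L (suc a) + H (pred b))) - x)
        (trans (fourier-factors t ℓ′ (∁ T)) (cong (λ U → L b + H ∣ U ∣) (BooleanAlgebra.¬-involutive (∪-∩-booleanAlgebra m) T))) ⟩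
  q * (L a + H b) - (fromℕ a * (L (pred a) + H (suc b)) + fromℕ b * (L (suc a) + H (pred b))) - (L b + H a)
    ≡⟨ solve 11 (λ q a b la hb lp hs ls hp lb ha →
         q :* (la :+ hb) :- (a :* (lp :+ hs) :+ b :* (ls :+ hp)) :- (lb :+ ha)
         := (q :* la :- a :* lp :- b :* ls :- ha) :+ (q :* hb :- b :* hp :- a :* hs :- lb))
         refl q (fromℕ a) (fromℕ b) (L a) (H b) (L (pred a)) (H (suc b)) (L (suc a)) (H (pred b)) (L b) (H a) ⟩
  (q * L a - fromℕ a * L (pred a) - fromℕ b * L (suc a) - H a)
    + (q * H b - fromℕ b * H (pred b) - fromℕ a * H (suc b) - L b)
    -- From n = 1 + a + b, the factor b becomes n - 1 - a and the factor a becomes n - 1 - b, as in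
    -- the definitions of `low` and `high`.
    ≡⟨ cong₂ (λ x y → (q * L a - fromℕ a * L (pred a) - x * L (suc a) - H a)
                    + (q * H b - fromℕ b * H (pred b) - y * H (suc b) - L b))
         (trans (solve 2 (λ a b → b := con 1ℚ :+ (a :+ b) :- con 1ℚ :- a) refl (fromℕ a) (fromℕ b)) (cong (λ x → x - 1ℚ - fromℕ a) (sym n≡)))
         (trans (solve 2 (λ a b → a := con 1ℚ :+ (a :+ b) :- con 1ℚ :- b) refl (fromℕ a) (fromℕ b)) (cong (λ x → x - 1ℚ - fromℕ b) (sym n≡))) ⟩
  low (suc t) a ℓ n + high (suc t) b ℓ n ∎
  where
  n = suc m
  ℓ′ = ℓ ∘ suc
  q = fromℕ n - fromℕ 4 * fromℕ (ℓ zero)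
  a = ∣ T ∣
  b = ∣ ∁ T ∣
  L H : ℕ → ℚ
  L s = low t s ℓ′ n
  H s = high t s ℓ′ n
  F : Subset m → ℚ
  F = fourier (factors ℓ′ n)
  n≡ : fromℕ n ≡ 1ℚ + (fromℕ a + fromℕ b)
  n≡ = begin
    fromℕ (suc m) ≡⟨ fromℕ-+ 1 m ⟩
    1ℚ + fromℕ m ≡⟨ cong (λ k → 1ℚ + fromℕ k) (∣T∣+∣∁T∣ T) ⟨
    1ℚ + fromℕ (a ℕ.+ b) ≡⟨ cong (λ x → 1ℚ + x) (fromℕ-+ a b) ⟩
    1ℚ + (fromℕ a + fromℕ b) ∎

-- The coefficients of f

leading-cast : ∀ {D D′} → D ≡ D′ → Leading D c φ → Leading D′ c φ
leading-cast refl L = L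

vanish : ∀ {D} → D ≡ 0 → Leading D c φ → ∀ ℓ n → φ ℓ n ≡ 0ℚ
vanish refl = proj₂

-- An index i > d would satisfy e ≤ i, beyond the end of the list. The case e = 0 is d = -1, with no
-- coefficients left.
length⇒degree : ∀ {e} {d : ℤ.ℤ} (p : Poly (suc t)) → length p ≤ e → ℤ.suc d ≡ + e → DegreeAtMost t d p
length⇒degree p len d+1≡e i d<i = contradiction
  (ℕ.≤-trans len (ℤ.drop‿+≤+ (subst (ℤ._≤ + toℕ i) d+1≡e (ℤ.i<j⇒suc[i]≤j d<i))))
  (ℕ.<⇒≱ (toℕ<n i))

suc[i-j-1] : ∀ i j → ℤ.suc (i ℤ.- j ℤ.- + 1) ≡ i ℤ.- j
suc[i-j-1] = Z.solve 2 (λ i j → Z.con (+ 1) Z.:+ (i Z.:- j Z.:- Z.con (+ 1)) Z.:= i Z.:- j) refl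

suc[i-j-2] : ∀ i j → ℤ.suc (i ℤ.- j ℤ.- + 2) ≡ i ℤ.- (+ 1 ℤ.+ j)
suc[i-j-2] = Z.solve 2 (λ i j → Z.con (+ 1) Z.:+ (i Z.:- j Z.:- Z.con (+ 2)) Z.:= i Z.:- (Z.con (+ 1) Z.:+ j)) refl

pos-∸ : ∀ {a b} → b ≤ a → + a ℤ.- + b ≡ + (a ∸ b)
pos-∸ {a} {b} b≤a = trans (ℤ.m-n≡m⊖n a b) (ℤ.⊖-≥ b≤a)

empty⇒zero : ∀ (p : Poly (suc t)) → length p ≤ 0 → IsZero (suc t) p
empty⇒zero [] _ = []

fourier-f : ∀ t (ℓ : Fin t → ℕ) (T : Subset m) →
  fourier (f ℓ (suc m)) T ≡ ½ ^ t * (low t (∣ T ∣) ℓ (suc m) + high t (∣ ∁ T ∣) ℓ (suc m))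
fourier-f {m} t ℓ T = trans (fourier-* (½ ^ t) (factors ℓ (suc m)) T) (cong (½ ^ t *_) (fourier-factors t ℓ T))

-- Vanishing is the case of `leading-low` in which the truncated degree bound is 0; likewise for
-- `high≡0`.
low≡0 : ∀ {t s} → t < s → ∀ ℓ n → low t s ℓ n ≡ 0ℚ
low≡0 {t} {s} t<s = vanish (ℕ.m≤n⇒m∸n≡0 t<s) (leading-low t s)

high≡0 : ∀ {t s} → t ≤ s → ∀ ℓ n → high t s ℓ n ≡ 0ℚ
high≡0 {t} {s} t≤s = vanish (ℕ.m≤n⇒m∸n≡0 t≤s) (leading-high t s)

-- With the bound in the form `suc _`, `Leading` unfolds to a pair whose first component is the
-- remainder polynomial sought; `highTop` does the same for part (ii).
lowTop : ∀ t {s} → s ≤ t → Leading (suc (t ∸ s)) (½ ^ t * lowLead t s) (λ ℓ n → ½ ^ t * low t s ℓ n)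
lowTop t {s} s≤t = leading-scale {D = suc (t ∸ s)} (½ ^ t) (leading-cast (ℕ.+-∸-assoc 1 s≤t) (leading-low t s))

highTop : ∀ t {s} → s < t → Leading (suc (t ∸ suc s)) (½ ^ t * highLead t s) (λ ℓ n → ½ ^ t * high t s ℓ n)
highTop t {s} s<t = leading-scale {D = suc (t ∸ suc s)} (½ ^ t)
  (leading-cast (ℕ.+-∸-assoc 1 s<t) (leading-high t s))

theorem3p3 : ∀ (t : ℕ) → 1 ≤ t →
    Σ[ R ∈ (Fin (suc t) → Poly (suc t)) ]
    Σ[ R′ ∈ (Fin t → Poly (suc t)) ]
    (∀ s → DegreeAtMost t (+ t ℤ.- + toℕ s ℤ.- + 1) (R s)) ×
    (∀ s → toℕ s ≡ t → IsZero (suc t) (R s)) ×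
    (∀ s → DegreeAtMost t (+ t ℤ.- + toℕ s ℤ.- + 2) (R′ s)) ×
    (∀ s → toℕ s ≡ t ∸ 1 → IsZero (suc t) (R′ s)) ×
    (∀ (ℓ : Fin t → ℕ) → (∀ j → 1 ≤ ℓ j) → Injective _≡_ _≡_ ℓ →
    ∀ (n : ℕ) → 2 ℕ.* t ℕ.+ 1 < n →
    ∀ (T : Subset (n ∸ 1)) →
    (∀ (s : Fin (suc t)) → ∣ T ∣ ≡ toℕ s →
    fourier (f ℓ n) T
    ≡ (- 1ℚ) ^ toℕ s * ½ ^ t * (t !/ (t ∸ toℕ s) !) * fromℕ n ^ (t ∸ toℕ s)
    + evalAt (R s) ℓ n) ×
    (∀ (s : Fin t) → ∣ T ∣ ≡ (n ∸ 1) ∸ toℕ s →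
    fourier (f ℓ n) T
    ≡ (- 1ℚ) ^ (toℕ s ℕ.+ 1) * ½ ^ t * (t !/ (t ∸ toℕ s ∸ 1) !) * fromℕ n ^ (t ∸ 1 ∸ toℕ s)
    + evalAt (R′ s) ℓ n) ×
    (t < ∣ T ∣ → ∣ T ∣ < (n ∸ 1) ∸ t ℕ.+ 1 →
    fourier (f ℓ n) T ≡ 0ℚ))
theorem3p3 t 1≤t = R , R′ , degR , zeroR , degR′ , zeroR′ , λ where
    -- The bound on n forces a successor, so that `n ∸ 1` computes to m.
    ℓ _ _ (suc m) (s≤s 2t+1≤m) T → coefficients m ℓ T 2t+1≤m
  where
  s≤t : ∀ (s : Fin (suc t)) → toℕ s ≤ t
  s≤t = toℕ≤pred[n]
  -- The remainders are built from t and s alone, hence are uniform in ℓ, n and T.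
  R : Fin (suc t) → Poly (suc t)
  R s = proj₁ (lowTop t (s≤t s))
  R′ : Fin t → Poly (suc t)
  R′ s = proj₁ (highTop t (toℕ<n s))
  lenR : ∀ s → length (R s) ≤ t ∸ toℕ s
  lenR s = proj₁ (proj₂ (lowTop t (s≤t s)))
  lenR′ : ∀ s → length (R′ s) ≤ t ∸ suc (toℕ s)
  lenR′ s = proj₁ (proj₂ (highTop t (toℕ<n s)))
  degR : ∀ s → DegreeAtMost t (+ t ℤ.- + toℕ s ℤ.- + 1) (R s)
  degR s = length⇒degree (R s) (lenR s) (trans (suc[i-j-1] (+ t) (+ toℕ s)) (pos-∸ (s≤t s)))
  zeroR : ∀ s → toℕ s ≡ t → IsZero (suc t) (R s)
  zeroR s s≡t = empty⇒zero (R s) (subst (length (R s) ≤_) (ℕ.m≤n⇒m∸n≡0 (ℕ.≤-reflexive (sym s≡t))) (lenR s))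
  degR′ : ∀ s → DegreeAtMost t (+ t ℤ.- + toℕ s ℤ.- + 2) (R′ s)
  degR′ s = length⇒degree (R′ s) (lenR′ s) (trans (suc[i-j-2] (+ t) (+ toℕ s)) (pos-∸ (toℕ<n s)))
  zeroR′ : ∀ s → toℕ s ≡ t ∸ 1 → IsZero (suc t) (R′ s)
  zeroR′ s s≡t-1 = empty⇒zero (R′ s) (subst (length (R′ s) ≤_)
    -- Here t ≤ 1 + (t ∸ 1) = 1 + s, so the length bound `t ∸ suc s` is 0.
    (ℕ.m≤n⇒m∸n≡0 (ℕ.≤-trans (ℕ.m≤n+m∸n t 1) (ℕ.≤-reflexive (cong suc (sym s≡t-1))))) (lenR′ s))
  coefficients : ∀ m (ℓ : Fin t → ℕ) (T : Subset m) → 2 ℕ.* t ℕ.+ 1 ≤ m →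
    (∀ (s : Fin (suc t)) → ∣ T ∣ ≡ toℕ s →
    fourier (f ℓ (suc m)) T
    ≡ (- 1ℚ) ^ toℕ s * ½ ^ t * (t !/ (t ∸ toℕ s) !) * fromℕ (suc m) ^ (t ∸ toℕ s)
    + evalAt (R s) ℓ (suc m)) ×
    (∀ (s : Fin t) → ∣ T ∣ ≡ m ∸ toℕ s →
    fourier (f ℓ (suc m)) T
    ≡ (- 1ℚ) ^ (toℕ s ℕ.+ 1) * ½ ^ t * (t !/ (t ∸ toℕ s ∸ 1) !) * fromℕ (suc m) ^ (t ∸ 1 ∸ toℕ s)
    + evalAt (R′ s) ℓ (suc m)) ×
    (t < ∣ T ∣ → ∣ T ∣ < m ∸ t ℕ.+ 1 →
    fourier (f ℓ (suc m)) T ≡ 0ℚ)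
  coefficients m ℓ T 2t+1≤m = small , large , middle
    where
    n = suc m
    1+t+t≤m : suc t ℕ.+ t ≤ m
    1+t+t≤m = subst (_≤ m) (trans (ℕ.+-comm (2 ℕ.* t) 1) (cong (λ x → suc (t ℕ.+ x)) (ℕ.+-identityʳ t))) 2t+1≤m
    t≤m = ℕ.≤-trans (ℕ.m≤n+m t (suc t)) 1+t+t≤m
    -- This separates the two ranges: if ∣T∣ = s ≤ t the complement is too large for `high`, and if
    -- ∣T∣ = m - s the set itself is too large for `low`.
    1+t≤m∸ : ∀ {s} → s ≤ t → suc t ≤ m ∸ s
    1+t≤m∸ {s} s≤t = ℕ.m+n≤o⇒m≤o∸n (suc t) (ℕ.≤-trans (ℕ.+-monoʳ-≤ (suc t) s≤t) 1+t+t≤m)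
    at : ∀ a → ∣ T ∣ ≡ a → fourier (f ℓ n) T ≡ ½ ^ t * (low t a ℓ n + high t (m ∸ a) ℓ n)
    at a refl = trans (fourier-f t ℓ T) (cong (λ b → ½ ^ t * (low t (∣ T ∣) ℓ n + high t b ℓ n)) (∣∁p∣≡n∸∣p∣ T))
    rearrange : ∀ h σ x y p → h * (σ * x) * y + p ≡ σ * h * x * y + p
    rearrange = solve 5 (λ h σ x y p → h :* (σ :* x) :* y :+ p := σ :* h :* x :* y :+ p) refl

    small : ∀ (s : Fin (suc t)) → ∣ T ∣ ≡ toℕ s → fourier (f ℓ n) T
      ≡ (- 1ℚ) ^ toℕ s * ½ ^ t * (t !/ (t ∸ toℕ s) !) * fromℕ n ^ (t ∸ toℕ s) + evalAt (R s) ℓ n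
    small s ∣T∣≡s = begin
      fourier (f ℓ n) T
        ≡⟨ at k ∣T∣≡s ⟩
      ½ ^ t * (low t k ℓ n + high t (m ∸ k) ℓ n)
        ≡⟨ cong (λ x → ½ ^ t * (low t k ℓ n + x)) (high≡0 (ℕ.<⇒≤ (1+t≤m∸ (s≤t s))) ℓ n) ⟩
      ½ ^ t * (low t k ℓ n + 0ℚ)
        ≡⟨ cong (½ ^ t *_) (ℚ.+-identityʳ (low t k ℓ n)) ⟩
      ½ ^ t * low t k ℓ n
        ≡⟨ proj₂ (proj₂ (lowTop t (s≤t s))) ℓ n ⟩
      ½ ^ t * ((- 1ℚ) ^ k * fromℕ (t ↓ k)) * fromℕ n ^ (t ∸ k) + evalAt (R s) ℓ n
        ≡⟨ rearrange (½ ^ t) ((- 1ℚ) ^ k) (fromℕ (t ↓ k)) (fromℕ n ^ (t ∸ k)) (evalAt (R s) ℓ n) ⟩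
      (- 1ℚ) ^ k * ½ ^ t * fromℕ (t ↓ k) * fromℕ n ^ (t ∸ k) + evalAt (R s) ℓ n
        ≡⟨ cong (λ x → (- 1ℚ) ^ k * ½ ^ t * x * fromℕ n ^ (t ∸ k) + evalAt (R s) ℓ n) (!/!≡↓ (s≤t s)) ⟨
      (- 1ℚ) ^ k * ½ ^ t * (t !/ (t ∸ k) !) * fromℕ n ^ (t ∸ k) + evalAt (R s) ℓ n ∎
      where k = toℕ s

    large : ∀ (s : Fin t) → ∣ T ∣ ≡ m ∸ toℕ s → fourier (f ℓ n) T
      ≡ (- 1ℚ) ^ (toℕ s ℕ.+ 1) * ½ ^ t * (t !/ (t ∸ toℕ s ∸ 1) !) * fromℕ n ^ (t ∸ 1 ∸ toℕ s) + evalAt (R′ s) ℓ n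
    large s ∣T∣≡m-s = begin
      fourier (f ℓ n) T
        ≡⟨ at (m ∸ k) ∣T∣≡m-s ⟩
      ½ ^ t * (low t (m ∸ k) ℓ n + high t (m ∸ (m ∸ k)) ℓ n)
        ≡⟨ cong₂ (λ x y → ½ ^ t * (x + high t y ℓ n)) (low≡0 (1+t≤m∸ k≤t) ℓ n) (ℕ.m∸[m∸n]≡n (ℕ.≤-trans k≤t t≤m)) ⟩
      ½ ^ t * (0ℚ + high t k ℓ n)
        ≡⟨ cong (½ ^ t *_) (ℚ.+-identityˡ (high t k ℓ n)) ⟩
      ½ ^ t * high t k ℓ n
        ≡⟨ proj₂ (proj₂ (highTop t (toℕ<n s))) ℓ n ⟩
      ½ ^ t * ((- 1ℚ) ^ suc k * fromℕ (t ↓ suc k)) * fromℕ n ^ (t ∸ suc k) + evalAt (R′ s) ℓ n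
        ≡⟨ rearrange (½ ^ t) ((- 1ℚ) ^ suc k) (fromℕ (t ↓ suc k)) (fromℕ n ^ (t ∸ suc k)) (evalAt (R′ s) ℓ n) ⟩
      (- 1ℚ) ^ suc k * ½ ^ t * fromℕ (t ↓ suc k) * fromℕ n ^ (t ∸ suc k) + evalAt (R′ s) ℓ n
        -- The truncated differences `t ∸ 1 ∸ k` and `t ∸ k ∸ 1` of the statement both equal
        -- `t ∸ suc k`.
        ≡⟨ cong₂ (λ x e → (- 1ℚ) ^ suc k * ½ ^ t * x * fromℕ n ^ e + evalAt (R′ s) ℓ n)
             (!/!≡↓ (toℕ<n s)) (ℕ.∸-+-assoc t 1 k) ⟨
      (- 1ℚ) ^ suc k * ½ ^ t * (t !/ (t ∸ suc k) !) * fromℕ n ^ (t ∸ 1 ∸ k) + evalAt (R′ s) ℓ n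
        ≡⟨ cong₂ (λ a b → (- 1ℚ) ^ a * ½ ^ t * (t !/ b !) * fromℕ n ^ (t ∸ 1 ∸ k) + evalAt (R′ s) ℓ n)
             (ℕ.+-comm k 1) (trans (ℕ.∸-+-assoc t k 1) (cong (t ∸_) (ℕ.+-comm k 1))) ⟨
      (- 1ℚ) ^ (k ℕ.+ 1) * ½ ^ t * (t !/ (t ∸ k ∸ 1) !) * fromℕ n ^ (t ∸ 1 ∸ k) + evalAt (R′ s) ℓ n ∎
      where
      k = toℕ s
      k≤t = ℕ.<⇒≤ (toℕ<n s)

    middle : t < ∣ T ∣ → ∣ T ∣ < m ∸ t ℕ.+ 1 → fourier (f ℓ n) T ≡ 0ℚ
    middle t<∣T∣ ∣T∣<m-t+1 = begin
      fourier (f ℓ n) T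
        ≡⟨ at (∣ T ∣) refl ⟩
      ½ ^ t * (low t (∣ T ∣) ℓ n + high t (m ∸ ∣ T ∣) ℓ n)
        -- `low` vanishes from t + 1 on but `high` already from t on, whence the asymmetric range t
        -- < ∣T∣ ≤ m - t.
        ≡⟨ cong₂ (λ x y → ½ ^ t * (x + y)) (low≡0 t<∣T∣ ℓ n) (high≡0 t≤m-∣T∣ ℓ n) ⟩
      ½ ^ t * (0ℚ + 0ℚ)
        ≡⟨ ℚ.*-zeroʳ (½ ^ t) ⟩
      0ℚ ∎
      where
      ∣T∣≤m-t : ∣ T ∣ ≤ m ∸ t
      ∣T∣≤m-t = ℕ.s≤s⁻¹ (subst (suc ∣ T ∣ ≤_) (ℕ.+-comm (m ∸ t) 1) ∣T∣<m-t+1)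
      t≤m-∣T∣ : t ≤ m ∸ ∣ T ∣
      t≤m-∣T∣ = ℕ.m+n≤o⇒m≤o∸n t (subst (_≤ m) (ℕ.+-comm ∣ T ∣ t) (ℕ.m≤o∸n⇒m+n≤o (∣ T ∣) t≤m ∣T∣≤m-t))
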